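{- There is a constant $C>0$ such that, for every $d>0$, any triangle-free graph on $n$ vertices with minimum degree at least $d$ has list chromatic number at most $C\min\{\sqrt{n},\, (n\log n)/d\}$.
   Context: $\log$ is the natural logarithm. The list chromatic number of $G$ is the least $k$ such that for every assignment of lists of $k$ colours to the vertices there is a proper colouring choosing each vertex's colour from its list. -}

module Defs where

open import Data.Nat using (ℕ; _+_; _*_; _≤_)
open import Data.Bool using (Bool; true; false; if_then_else_)
open import Data.Fin using (Fin)
open import Data.List using (List; length; map; allFin)
open import Data.Nat.ListAction using (sum)
open import Data.List.Membership.Propositional using (_∈_)
open import Data.List.Relation.Unary.Unique.Propositional using (Unique)
open import Data.Product using (Σ; _×_; ∃)
open import Relation.Binary.PropositionalEquality using (_≡_; _≢_)
open import Relation.Nullary using (¬_)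

record Graph (n : ℕ) : Set where
  field
    adj     : Fin n → Fin n → Bool
    symm    : ∀ u v → adj u v ≡ adj v u
    irrefl  : ∀ v → adj v v ≡ false
open Graph public

degree : ∀ {n} → Graph n → Fin n → ℕ
degree {n} G v = sum (map (λ w → if adj G v w then 1 else 0) (allFin n))

MinDegreeAtLeast : ∀ {n} → Graph n → ℕ → Set
MinDegreeAtLeast G d = ∀ v → d ≤ degree G v

TriangleFree : ∀ {n} → Graph n → Set
TriangleFree {n} G = ∀ (u v w : Fin n) →
  ¬ (adj G u v ≡ true × adj G v w ≡ true × adj G u w ≡ true)

Choosable : ∀ {n} → Graph n → ℕ → Set
Choosable {n} G k =
  (L : Fin n → List ℕ) →
  (∀ v → length (L v) ≡ k) →
  (∀ v → Unique (L v)) →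
  Σ (Fin n → ℕ) λ c →
    (∀ v → c v ∈ L v) × (∀ u v → adj G u v ≡ true → c u ≢ c v)

ListChromaticAtMost : ∀ {n} → Graph n → (ℕ → Set) → Set
ListChromaticAtMost G Bound = ∃ λ k → Choosable G k × Bound k

{-# OPTIONS --safe #-}

-- In a triangle-free graph a colour c may be given to any set of vertices inside one
-- neighbourhood N(u), after which c is discarded.
--
-- Degree bound: give each colour c the neighbourhood of a random vertex. A vertex with k
-- colours stays uncoloured with probability at most (1 - d/n)^k, which is below 1/n once k
-- exceeds about (n log n)/d; the choices are derandomised by conditional expectations.
--
-- Square-root bound: as long as some c is available at s = ⌈√n⌉ uncoloured neighbours of some
-- u, colour those with c. This happens at most s times, so from lists of size 5s it leaves
-- lists of size at least 4s in which every colour is available at no more than s neighbours of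
-- any vertex. Such a list colouring exists by Rosenfeld's counting argument: each further
-- vertex multiplies the number of proper colourings by at least 2s.
module Submission where

open import Defs
open import Data.Nat using (ℕ; _+_; _*_; _≤_)
open import Data.Nat.Logarithm using (⌊log₂_⌋)
open import Data.Product using (Σ; _×_)

open import Algebra.Properties.CommutativeSemigroup using (interchange; x∙yz≈y∙xz)
open import Data.Bool using (Bool; true; false; if_then_else_; _∧_; not; T)
open import Data.Bool.Properties using (∧-assoc; ∧-comm; ∧-identityʳ)
open import Data.Fin using (Fin)
open import Data.Fin.Properties using (any?) renaming (_≟_ to _≟ᶠ_)
open import Data.List using (List; []; _∷_; length; map; allFin; filterᵇ; upTo)
open import Data.List.Membership.Propositional using (_∈_; find; lose)
open import Data.List.Membership.Propositional.Properties using (∈-filter⁺; ∈-upTo⁺; ∈-allFin)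
open import Data.List.Properties using (map-cong; map-∘; length-tabulate)
open import Data.List.Relation.Binary.Permutation.Propositional
  using (_↭_; prep; swap) renaming (refl to refl↭; trans to trans↭)
open import Data.List.Relation.Binary.Permutation.Propositional.Properties
  using (map⁺; ↭-length)
open import Data.List.Relation.Unary.All as All using (All; []; _∷_)
import Data.List.Relation.Unary.All.Properties as All
open import Data.List.Relation.Unary.AllPairs using ([]; _∷_)
open import Data.List.Relation.Unary.Any as Any using (here; there)
open import Data.List.Relation.Unary.Unique.Propositional using (Unique)
open import Data.List.Relation.Unary.Unique.Propositional.Properties using (upTo⁺)
open import Data.Nat using
  (zero; suc; z≤n; s≤s; _<_; _∸_; _^_; _≡ᵇ_; _≟_; _≤?_; NonZero; ≢-nonZero; >-nonZero⁻¹)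
open import Data.Nat.DivMod using (_/_; m/n*n≤m; m%n<n; m≡m%n+[m/n]*n)
open import Data.Nat.ListAction using (sum)
open import Data.Nat.ListAction.Properties using (sum-↭)
open import Data.Nat.Logarithm using (⌊log₂⌋-mono-≤; ⌊log₂[2^n]⌋≡n)
open import Data.Nat.Properties
open import Data.Nat.Tactic.RingSolver using (solve-∀)
open import Data.Product using (_,_; proj₁; proj₂; ∃; ∃₂)
open import Data.Sum using (_⊎_; inj₁; inj₂)
open import Function using (_∘_; case_of_)
open import Relation.Binary.PropositionalEquality
  using (_≡_; _≢_; _≗_; refl; sym; trans; cong; cong₂; subst; subst₂; module ≡-Reasoning)
open import Relation.Nullary using (yes; no; does; contradiction; ⌊_⌋)
open import Relation.Nullary.Decidable using (toWitness)
open import Data.List.Membership.DecPropositional _≟_ using (_∈?_)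

-- Sums over lists and averaging.

*-left-comm : ∀ a b c → a * (b * c) ≡ b * (a * c)
*-left-comm = x∙yz≈y∙xz *-commutativeSemigroup

*-interchange : ∀ a b c d → a * b * (c * d) ≡ a * c * (b * d)
*-interchange = interchange *-commutativeSemigroup

+-interchange : ∀ a b c d → a + b + (c + d) ≡ a + c + (b + d)
+-interchange = interchange +-commutativeSemigroup

𝟙 : Bool → ℕ
𝟙 b = if b then 1 else 0

∑ : {X : Set} → List X → (X → ℕ) → ℕ
∑ xs f = sum (map f xs)

private variable
  X Y : Set

∑-mono : (xs : List X) {f g : X → ℕ} → (∀ {x} → x ∈ xs → f x ≤ g x) → ∑ xs f ≤ ∑ xs g
∑-mono []       f≤g = z≤n
∑-mono (x ∷ xs) f≤g = +-mono-≤ (f≤g (here refl)) (∑-mono xs (f≤g ∘ there))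

∑-cong : (xs : List X) {f g : X → ℕ} → f ≗ g → ∑ xs f ≡ ∑ xs g
∑-cong xs f≗g = cong sum (map-cong f≗g xs)

∑-distrib-+ : (xs : List X) (f g : X → ℕ) → ∑ xs (λ x → f x + g x) ≡ ∑ xs f + ∑ xs g
∑-distrib-+ []       f g = refl
∑-distrib-+ (x ∷ xs) f g rewrite ∑-distrib-+ xs f g =
  +-interchange (f x) (g x) (∑ xs f) (∑ xs g)

*-distribˡ-∑ : (k : ℕ) (xs : List X) (f : X → ℕ) → ∑ xs (λ x → k * f x) ≡ k * ∑ xs f
*-distribˡ-∑ k []       f = sym (*-zeroʳ k)
*-distribˡ-∑ k (x ∷ xs) f rewrite *-distribˡ-∑ k xs f = sym (*-distribˡ-+ k (f x) _)

*-distribʳ-∑ : (k : ℕ) (xs : List X) (f : X → ℕ) → ∑ xs (λ x → f x * k) ≡ ∑ xs f * k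
*-distribʳ-∑ k xs f = trans (∑-cong xs (λ x → *-comm (f x) k))
  (trans (*-distribˡ-∑ k xs f) (*-comm k _))

∑-const : (k : ℕ) (xs : List X) → ∑ xs (λ _ → k) ≡ length xs * k
∑-const k []       = refl
∑-const k (_ ∷ xs) = cong (k +_) (∑-const k xs)

∑-↭ : {xs ys : List X} (f : X → ℕ) → xs ↭ ys → ∑ xs f ≡ ∑ ys f
∑-↭ f p = sum-↭ (map⁺ f p)

∑-map : (h : X → Y) (xs : List X) (f : Y → ℕ) → ∑ (map h xs) f ≡ ∑ xs (f ∘ h)
∑-map h xs f = cong sum (sym (map-∘ xs))

∑-swap : (xs : List X) (ys : List Y) (f : X → Y → ℕ) →
  ∑ xs (λ x → ∑ ys (f x)) ≡ ∑ ys (λ y → ∑ xs (λ x → f x y))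
∑-swap []       ys f = sym (trans (∑-const 0 ys) (*-zeroʳ (length ys)))
∑-swap (x ∷ xs) ys f = trans (cong (∑ ys (f x) +_) (∑-swap xs ys f))
  (sym (∑-distrib-+ ys (f x) (λ y → ∑ xs (λ x → f x y))))

term≤∑ : {xs : List X} {x : X} (f : X → ℕ) → x ∈ xs → f x ≤ ∑ xs f
term≤∑ f (here refl) = m≤m+n _ _
term≤∑ f (there x∈)  = ≤-trans (term≤∑ f x∈) (m≤n+m _ _)

0<∑⇒∃ : (xs : List X) (f : X → ℕ) → 0 < ∑ xs f → ∃ λ x → 0 < f x
0<∑⇒∃ (x ∷ xs) f 0<∑ with f x in eq
... | zero  = 0<∑⇒∃ xs f 0<∑
... | suc k = x , subst (0 <_) (sym eq) (s≤s z≤n)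

-- If the head falls below `b`, the tail still averages at least `b`, so the search continues there;
-- a single entry is its own average.
averaging : (b : ℕ) (xs : List X) (f : X → ℕ) → 0 < length xs → b * length xs ≤ ∑ xs f →
  ∃ λ x → b ≤ f x
averaging b (x ∷ xs) f _ le with b ≤? f x
... | yes b≤fx = x , b≤fx
averaging b (x ∷ []) f _ le | no b≰fx =
  x , subst (b ≤_) (+-identityʳ (f x)) (subst (_≤ f x + 0) (*-identityʳ b) le)
averaging b (x ∷ y ∷ xs) f _ le | no b≰fx = averaging b (y ∷ xs) f (s≤s z≤n)
  (+-cancelˡ-≤ b _ _ (≤-trans (subst (_≤ f x + ∑ (y ∷ xs) f) (*-suc b (length (y ∷ xs))) le)
    (+-monoˡ-≤ _ (<⇒≤ (≰⇒> b≰fx)))))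

-- Splitting lists and removing entries.

rest : (X → Bool) → List X → List X
rest p = filterᵇ (not ∘ p)

∑-rest : (p : X → Bool) (xs : List X) (f : X → ℕ) →
  ∑ xs (λ x → 𝟙 (p x) * f x) + ∑ (rest p xs) f ≡ ∑ xs f
∑-rest p []       f = refl
∑-rest p (x ∷ xs) f with p x
... | true  = trans (+-assoc (1 * f x) _ _) (cong₂ _+_ (*-identityˡ (f x)) (∑-rest p xs f))
... | false = trans (lemma (∑ xs (λ x → 𝟙 (p x) * f x)) (f x) (∑ (rest p xs) f))
                (cong (f x +_) (∑-rest p xs f))
  where
  lemma : ∀ a b c → a + (b + c) ≡ b + (a + c)
  lemma = solve-∀

length-rest : (p : X → Bool) (xs : List X) → ∑ xs (𝟙 ∘ p) + length (rest p xs) ≡ length xs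
length-rest p []       = refl
length-rest p (x ∷ xs) with p x
... | true  = cong suc (length-rest p xs)
... | false = trans (+-suc _ _) (cong suc (length-rest p xs))

∈-rest : (p : X → Bool) {xs : List X} {x : X} → x ∈ xs → p x ≡ false → x ∈ rest p xs
∈-rest p x∈xs px≡false = ∈-filter⁺ _ x∈xs (subst (T ∘ not) (sym px≡false) _)

-- Entries are taken out by position. Rosenfeld's induction needs this because it removes an
-- arbitrary neighbour, not only the head.
picks : List X → List (X × List X)
picks []       = []
picks (x ∷ xs) = (x , xs) ∷ map (λ (y , ys) → y , x ∷ ys) (picks xs)

picks-↭ : (xs : List X) → All (λ (y , ys) → xs ↭ y ∷ ys) (picks xs)
picks-↭ []       = []
picks-↭ (x ∷ xs) = refl↭ ∷ All.map⁺ (All.map (λ p → trans↭ (prep x p) (swap x _ refl↭)) (picks-↭ xs))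

∑-picks : (xs : List X) (f : X → ℕ) → ∑ (picks xs) (f ∘ proj₁) ≡ ∑ xs f
∑-picks []       f = refl
∑-picks (x ∷ xs) f = cong (f x +_) (trans (∑-map _ (picks xs) (f ∘ proj₁)) (∑-picks xs f))

-- Indicators and membership of colours.

≡ᵇ-true : ∀ m n → (m ≡ᵇ n) ≡ true → m ≡ n
≡ᵇ-true m n eq = ≡ᵇ⇒≡ m n (subst T (sym eq) _)

≡ᵇ-refl : ∀ m → (m ≡ᵇ m) ≡ true
≡ᵇ-refl zero    = refl
≡ᵇ-refl (suc m) = ≡ᵇ-refl m

≡ᵇ-comm : ∀ m n → (m ≡ᵇ n) ≡ (n ≡ᵇ m)
≡ᵇ-comm zero    zero    = refl
≡ᵇ-comm zero    (suc n) = refl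
≡ᵇ-comm (suc m) zero    = refl
≡ᵇ-comm (suc m) (suc n) = ≡ᵇ-comm m n

≢⇒≡ᵇ-false : ∀ m n → m ≢ n → (m ≡ᵇ n) ≡ false
≢⇒≡ᵇ-false m n m≢n with m ≡ᵇ n in eq
... | true  = contradiction (≡ᵇ-true m n eq) m≢n
... | false = refl

∑-≡ᵇ-∉ : ∀ c {cs} → All (c ≢_) cs → ∑ cs (λ c′ → 𝟙 (c ≡ᵇ c′)) ≡ 0
∑-≡ᵇ-∉ c []         = refl
∑-≡ᵇ-∉ c (c≢ ∷ c∉) rewrite ≢⇒≡ᵇ-false c _ c≢ = ∑-≡ᵇ-∉ c c∉

∑-≡ᵇ≤1 : ∀ c {cs} → Unique cs → ∑ cs (λ c′ → 𝟙 (c ≡ᵇ c′)) ≤ 1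
∑-≡ᵇ≤1 c []           = z≤n
∑-≡ᵇ≤1 c (_∷_ {x} x∉ u) with c ≡ᵇ x in eq
... | false = ∑-≡ᵇ≤1 c u
... | true rewrite ≡ᵇ-true c x eq = ≤-reflexive (cong suc (∑-≡ᵇ-∉ x x∉))

∧-trueˡ : ∀ {a b} → a ∧ b ≡ true → a ≡ true
∧-trueˡ {true} _ = refl

∧-trueʳ : ∀ {a b} → a ∧ b ≡ true → b ≡ true
∧-trueʳ {true} e = e

𝟙-∧ : ∀ a b → 𝟙 (a ∧ b) ≡ 𝟙 a * 𝟙 b
𝟙-∧ true  b = sym (+-identityʳ (𝟙 b))
𝟙-∧ false b = refl

𝟙-mono : ∀ {a b} → (a ≡ true → b ≡ true) → 𝟙 a ≤ 𝟙 b
𝟙-mono {false} _   = z≤n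
𝟙-mono {true}  a⇒b rewrite a⇒b refl = ≤-refl

∈⇒≤sum : ∀ {c cs} → c ∈ cs → c ≤ sum cs
∈⇒≤sum (here refl) = m≤m+n _ _
∈⇒≤sum (there c∈)  = ≤-trans (∈⇒≤sum c∈) (m≤n+m _ _)

-- Turns the length of a list into a number of available colours. Since `L` has no repetitions, the
-- indicators of its head and of its tail are never both 1.
length≤∑ : ∀ cols {L} → Unique L → (∀ {c} → c ∈ L → c ∈ cols) →
  length L ≤ ∑ cols (λ c → 𝟙 ⌊ c ∈? L ⌋)
length≤∑ cols {[]}    []         L⊆ = z≤n
length≤∑ cols {x ∷ L} (x∉ ∷ uniq) L⊆ = begin
  1 + length L
    ≤⟨ +-mono-≤ (≤-trans (≤-reflexive (sym (cong 𝟙 (≡ᵇ-refl x)))) (term≤∑ (λ c → 𝟙 (x ≡ᵇ c)) (L⊆ (here refl))))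
         (length≤∑ cols uniq (L⊆ ∘ there)) ⟩
  ∑ cols (λ c → 𝟙 (x ≡ᵇ c)) + ∑ cols (λ c → 𝟙 ⌊ c ∈? L ⌋)
    ≡⟨ ∑-distrib-+ cols _ _ ⟨
  ∑ cols (λ c → 𝟙 (x ≡ᵇ c) + 𝟙 ⌊ c ∈? L ⌋)
    ≤⟨ ∑-mono cols (λ {c} _ → disjoint c) ⟩
  ∑ cols (λ c → 𝟙 ⌊ c ∈? (x ∷ L) ⌋) ∎
  where
  open ≤-Reasoning
  disjoint : ∀ c → 𝟙 (x ≡ᵇ c) + 𝟙 ⌊ c ∈? L ⌋ ≤ 𝟙 ⌊ c ∈? (x ∷ L) ⌋
  disjoint c with x ≡ᵇ c in eq | c ∈? L | c ∈? (x ∷ L)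
  ... | false | no _   | _       = z≤n
  ... | false | yes _  | yes _   = ≤-refl
  ... | false | yes c∈ | no c∉   = contradiction (there c∈) c∉
  ... | true  | no _   | yes _   = ≤-refl
  ... | true  | no _   | no c∉   = contradiction (here (sym (≡ᵇ-true x c eq))) c∉
  ... | true  | yes c∈ | _       = contradiction (≡ᵇ-true x c eq) (All.lookup x∉ c∈)

-- Partial colourings and discarding a colour.

module _ {n : ℕ} (G : Graph n) where

  -- A v c says that colour c is available at v.
  Colours : Set
  Colours = Fin n → ℕ → Bool

  Colourable : List (Fin n) → Colours → Set
  Colourable S A = Σ (Fin n → ℕ) λ f →
    (∀ v → v ∈ S → A v (f v) ≡ true) ×
    (∀ u v → u ∈ S → v ∈ S → adj G u v ≡ true → f u ≢ f v)

  _∖_ : Colours → ℕ → Colours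
  (A ∖ c) v c′ = A v c′ ∧ not (c ≡ᵇ c′)

  ∖-sub : ∀ A c {v c′} → (A ∖ c) v c′ ≡ true → A v c′ ≡ true
  ∖-sub A c = ∧-trueˡ

  ∖-≢ : ∀ A c {v c′} → (A ∖ c) v c′ ≡ true → c ≢ c′
  ∖-≢ A c {v} h refl with () ← subst (λ b → not b ≡ true) (≡ᵇ-refl c) (∧-trueʳ {A v c} h)

  hits : Colours → Fin n → ℕ → Fin n → Bool
  hits A u c v = adj G u v ∧ A v c

  -- The vertices that receive `c` lie in the neighbourhood of `u`, which is independent because `G`
  -- is triangle-free. All other vertices of `S` avoid `c`.
  colour-neighbours : TriangleFree G → ∀ A u c S →
    Colourable (rest (hits A u c) S) (A ∖ c) → Colourable S A
  colour-neighbours tf A u c S (f , ok , proper) = g , g-ok , g-proper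
    where
    g : Fin n → ℕ
    g v = if hits A u c v then c else f v

    g-ok : ∀ v → v ∈ S → A v (g v) ≡ true
    g-ok v v∈S with hits A u c v in eq
    ... | true  = ∧-trueʳ {adj G u v} eq
    ... | false = ∖-sub A c (ok v (∈-rest (hits A u c) v∈S eq))

    g-proper : ∀ v w → v ∈ S → w ∈ S → adj G v w ≡ true → g v ≢ g w
    g-proper v w v∈S w∈S vw with hits A u c v in eqv | hits A u c w in eqw
    ... | true  | true  = λ _ → tf u v w (∧-trueˡ eqv , vw , ∧-trueˡ eqw)
    ... | true  | false = ∖-≢ A c (ok w (∈-rest (hits A u c) w∈S eqw))
    ... | false | true  = ∖-≢ A c (ok v (∈-rest (hits A u c) v∈S eqv)) ∘ sym
    ... | false | false =
      proper v w (∈-rest (hits A u c) v∈S eqv) (∈-rest (hits A u c) w∈S eqw) vw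

  -- Colouring v with c makes c unavailable at the neighbours of v.
  block : Colours → Fin n → ℕ → Colours
  block A v c u c′ = A u c′ ∧ not (adj G v u ∧ (c ≡ᵇ c′))

  -- Rosenfeld's counting of colourings.

  module _ (cols : List ℕ) where

    -- Colours the positions of `S` one after another, so repeated vertices are coloured
    -- independently: `adj` is irreflexive and a vertex does not block itself.
    colourings : List (Fin n) → Colours → ℕ
    colourings []      A = 1
    colourings (v ∷ S) A = ∑ cols λ c → 𝟙 (A v c) * colourings S (block A v c)

    colourings-mono : ∀ S {A B} → (∀ v c → A v c ≡ true → B v c ≡ true) →
      colourings S A ≤ colourings S B
    colourings-mono []      A⊆B = ≤-refl
    colourings-mono (v ∷ S) {A} A⊆B = ∑-mono cols λ {c} _ → *-mono-≤ (𝟙-mono (A⊆B v c))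
      (colourings-mono S λ u c′ h → cong₂ _∧_ (A⊆B u c′ (∧-trueˡ h)) (∧-trueʳ {A u c′} h))

    colourings-cong : ∀ S {A B} → (∀ v c → A v c ≡ B v c) → colourings S A ≡ colourings S B
    colourings-cong S A≗B = ≤-antisym
      (colourings-mono S λ v c → trans (sym (A≗B v c)))
      (colourings-mono S λ v c → trans (A≗B v c))

    block-comm : ∀ A v c u c′ w x →
      block (block A v c) u c′ w x ≡ block (block A u c′) v c w x
    block-comm A v c u c′ w x = lemma (A w x) _ _
      where
      lemma : ∀ a b d → (a ∧ b) ∧ d ≡ (a ∧ d) ∧ b
      lemma a b d = trans (∧-assoc a b d) (trans (cong (a ∧_) (∧-comm b d)) (sym (∧-assoc a d b)))

    -- Whichever vertex comes first, the same pairs of colours survive, because adjacency and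
    -- equality of colours are symmetric; what remains available agrees by `block-comm`.
    colourings-swap : ∀ v u S A → colourings (v ∷ u ∷ S) A ≡ colourings (u ∷ v ∷ S) A
    colourings-swap v u S A = begin
      ∑ cols (λ c → 𝟙 (A v c) * ∑ cols (λ c′ → F v c u c′))
        ≡⟨ ∑-cong cols (λ c → sym (*-distribˡ-∑ (𝟙 (A v c)) cols (F v c u))) ⟩
      ∑ cols (λ c → ∑ cols (λ c′ → 𝟙 (A v c) * F v c u c′))
        ≡⟨ ∑-swap cols cols _ ⟩
      ∑ cols (λ c′ → ∑ cols (λ c → 𝟙 (A v c) * F v c u c′))
        ≡⟨ ∑-cong cols (λ c′ → ∑-cong cols (λ c → flip-term c c′)) ⟩
      ∑ cols (λ c′ → ∑ cols (λ c → 𝟙 (A u c′) * F u c′ v c))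
        ≡⟨ ∑-cong cols (λ c′ → *-distribˡ-∑ (𝟙 (A u c′)) cols (F u c′ v)) ⟩
      ∑ cols (λ c′ → 𝟙 (A u c′) * ∑ cols (F u c′ v)) ∎
      where
      open ≡-Reasoning
      F : Fin n → ℕ → Fin n → ℕ → ℕ
      F v c u c′ = 𝟙 (block A v c u c′) * colourings S (block (block A v c) u c′)

      exchange : ∀ a b x k → 𝟙 a * (𝟙 (b ∧ x) * k) ≡ 𝟙 b * (𝟙 (a ∧ x) * k)
      exchange true  true  x k = refl
      exchange true  false x k = refl
      exchange false true  x k = refl
      exchange false false x k = refl

      flip-term : ∀ c c′ → 𝟙 (A v c) * F v c u c′ ≡ 𝟙 (A u c′) * F u c′ v c
      flip-term c c′
        rewrite symm G u v | ≡ᵇ-comm c′ c | colourings-cong S (block-comm A v c u c′)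
        = exchange (A v c) (A u c′) _ _

    -- Allows any vertex to be moved to the front, although `colourings` recurses on the head only.
    colourings-↭ : ∀ {S S′} → S ↭ S′ → ∀ A → colourings S A ≡ colourings S′ A
    colourings-↭ refl↭        A = refl
    colourings-↭ (prep v p)   A =
      ∑-cong cols λ c → cong (𝟙 (A v c) *_) (colourings-↭ p (block A v c))
    colourings-↭ (swap {S} v u p) A = trans (colourings-swap v u S A)
      (∑-cong cols λ c → cong (𝟙 (A u c) *_)
        (∑-cong cols λ c′ → cong (𝟙 (block A u c v c′) *_) (colourings-↭ p _)))
    colourings-↭ (trans↭ p q) A = trans (colourings-↭ p A) (colourings-↭ q A)

    0<colourings⇒Colourable : ∀ S A → 0 < colourings S A → Colourable S A
    0<colourings⇒Colourable []      A _   = (λ _ → 0) , (λ _ ()) , λ _ _ ()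
    0<colourings⇒Colourable (v ∷ S) A pos with 0<∑⇒∃ cols _ pos
    ... | c , pos′ with A v c in eq
    ...   | true with 0<colourings⇒Colourable S (block A v c)
                        (subst (0 <_) (+-identityʳ _) pos′)
    ...     | f , ok , proper = g , g-ok , g-proper
      where
      -- Any later copy of `v` in `S` also gets `c`, overriding `f`. This is safe because `block`
      -- keeps `c` away from all neighbours of `v`.
      g : Fin n → ℕ
      g u = if does (u ≟ᶠ v) then c else f u

      f≢c : ∀ u → u ∈ S → adj G v u ≡ true → c ≢ f u
      f≢c u u∈S vu c≡fu with ∧-trueʳ {A u (f u)} (ok u u∈S)
      ... | h rewrite vu | sym c≡fu | ≡ᵇ-refl c with () ← h

      tail : ∀ {u} → u ∈ v ∷ S → u ≢ v → u ∈ S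
      tail (here u≡v)  u≢v = contradiction u≡v u≢v
      tail (there u∈S) _   = u∈S

      g-ok : ∀ u → u ∈ v ∷ S → A u (g u) ≡ true
      g-ok u u∈ with u ≟ᶠ v
      ... | yes refl = eq
      ... | no  u≢v  = ∧-trueˡ (ok u (tail u∈ u≢v))

      g-proper : ∀ u w → u ∈ v ∷ S → w ∈ v ∷ S → adj G u w ≡ true → g u ≢ g w
      g-proper u w u∈ w∈ uw with u ≟ᶠ v | w ≟ᶠ v
      ... | yes refl | yes refl with () ← trans (sym uw) (irrefl G v)
      ... | yes refl | no  w≢v  = f≢c w (tail w∈ w≢v) uw
      ... | no  u≢v  | yes refl = f≢c u (tail u∈ u≢v) (trans (symm G v u) uw) ∘ sym
      ... | no  u≢v  | no  w≢v  = proper u w (tail u∈ u≢v) (tail w∈ w≢v) uw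

    picks-hits : Colours → Fin n → ℕ → Fin n × List (Fin n) → ℕ
    picks-hits A v c (w , S) = 𝟙 (hits A v c w) * colourings S A

    -- A colouring of S that is lost when c is blocked around v gives colour c to
    -- a neighbour w of v, and restricts to a colouring of S − w.
    colourings-block : Unique cols → ∀ S A v c →
      colourings S A ≤ colourings S (block A v c) + ∑ (picks S) (picks-hits A v c)
    colourings-block uniq []      A v c = ≤-refl
    colourings-block uniq (u ∷ S) A v c = begin
      ∑ cols (λ c′ → 𝟙 (A u c′) * colourings S (block A u c′))
        ≤⟨ ∑-mono cols (λ {c′} _ → pointwise c′) ⟩
      ∑ cols (λ c′ → P c′ + Q c′ + R c′)
        ≡⟨ trans (∑-distrib-+ cols (λ c′ → P c′ + Q c′) R)
             (cong (_+ ∑ cols R) (∑-distrib-+ cols P Q)) ⟩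
      ∑ cols P + ∑ cols Q + ∑ cols R
        ≤⟨ +-mono-≤ (+-monoʳ-≤ (∑ cols P) ∑Q≤) (≤-reflexive ∑R≡) ⟩
      ∑ cols P + Z + ∑ (map cons-u (picks S)) (picks-hits A v c)
        ≡⟨ +-assoc (∑ cols P) Z _ ⟩
      ∑ cols P + (Z + ∑ (map cons-u (picks S)) (picks-hits A v c)) ∎
      where
      open ≤-Reasoning
      cons-u : Fin n × List (Fin n) → Fin n × List (Fin n)
      cons-u (y , ys) = y , u ∷ ys

      Z : ℕ
      Z = 𝟙 (hits A v c u) * colourings S A

      -- The head `u` gets `c′`. `P` counts the colourings that survive the blocking, `Q` bounds
      -- those lost because `u` itself is a neighbour of `v` coloured `c`, and `R` those lost
      -- because a vertex `w` of `S` is.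
      P Q R : ℕ → ℕ
      P c′ = 𝟙 (block A v c u c′) * colourings S (block (block A v c) u c′)
      Q c′ = 𝟙 (c ≡ᵇ c′) * Z
      R c′ = ∑ (picks S) λ (w , S′) →
        𝟙 (hits A v c w) * (𝟙 (A u c′) * colourings S′ (block A u c′))

      split : ∀ a e x a₀ X Z → (x ≡ true → a₀ ≡ a) → X ≤ Z →
        𝟙 a * X ≤ 𝟙 (a ∧ not (e ∧ x)) * X + 𝟙 x * (𝟙 (e ∧ a₀) * Z)
      split false e     x     a₀ X Z _  _   = z≤n
      split true  false x     a₀ X Z _  _   = m≤m+n _ _
      split true  true  false a₀ X Z _  _   = m≤m+n _ _
      split true  true  true  a₀ X Z eq X≤Z rewrite eq refl =
        ≤-trans (+-monoˡ-≤ 0 X≤Z) (m≤m+n _ _)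

      P+Q : ∀ c′ → 𝟙 (A u c′) * colourings S (block (block A u c′) v c) ≤ P c′ + Q c′
      P+Q c′ rewrite sym (colourings-cong S (block-comm A v c u c′)) =
        split (A u c′) (adj G v u) (c ≡ᵇ c′) (A u c) _ _
          (λ c≡ᵇc′ → cong (A u) (≡ᵇ-true c c′ c≡ᵇc′))
          (colourings-mono S λ w x → ∧-trueˡ ∘ ∧-trueˡ)

      weaken : ∀ c′ w k → 𝟙 (A u c′) * (𝟙 (hits (block A u c′) v c w) * k) ≤
        𝟙 (hits A v c w) * (𝟙 (A u c′) * k)
      weaken c′ w k = ≤-trans
        (*-monoʳ-≤ (𝟙 (A u c′)) (*-monoˡ-≤ k (𝟙-mono {hits (block A u c′) v c w} {hits A v c w} λ h →
          cong₂ _∧_ (∧-trueˡ {adj G v w} h) (∧-trueˡ {A w c} (∧-trueʳ {adj G v w} h)))))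
        (≤-reflexive (*-left-comm (𝟙 (A u c′)) (𝟙 (hits A v c w)) k))

      pointwise : ∀ c′ → 𝟙 (A u c′) * colourings S (block A u c′) ≤ P c′ + Q c′ + R c′
      pointwise c′ = begin
        𝟙 (A u c′) * colourings S (block A u c′)
          ≤⟨ *-monoʳ-≤ (𝟙 (A u c′)) (colourings-block uniq S (block A u c′) v c) ⟩
        𝟙 (A u c′) * (colourings S (block (block A u c′) v c) +
                       ∑ (picks S) (picks-hits (block A u c′) v c))
          ≡⟨ *-distribˡ-+ (𝟙 (A u c′)) _ _ ⟩
        𝟙 (A u c′) * colourings S (block (block A u c′) v c) +
        𝟙 (A u c′) * ∑ (picks S) (picks-hits (block A u c′) v c)
          ≤⟨ +-mono-≤ (P+Q c′) (≤-trans
               (≤-reflexive (sym (*-distribˡ-∑ (𝟙 (A u c′)) (picks S) _)))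
               (∑-mono (picks S) λ {(w , S′)} _ → weaken c′ w _)) ⟩
        P c′ + Q c′ + R c′ ∎

      -- Only one entry of the repetition-free `cols` can equal `c`, so the loss at `u` is charged
      -- once.
      ∑Q≤ : ∑ cols Q ≤ Z
      ∑Q≤ = begin
        ∑ cols Q                          ≡⟨ *-distribʳ-∑ Z cols (λ c′ → 𝟙 (c ≡ᵇ c′)) ⟩
        ∑ cols (λ c′ → 𝟙 (c ≡ᵇ c′)) * Z  ≤⟨ *-monoˡ-≤ Z (∑-≡ᵇ≤1 c uniq) ⟩
        1 * Z                             ≡⟨ *-identityˡ Z ⟩
        Z                                 ∎

      -- Summing over the colour `c′` of `u` turns colourings of `S′` back into colourings of
      -- `u ∷ S′`.
      ∑R≡ : ∑ cols R ≡ ∑ (map cons-u (picks S)) (picks-hits A v c)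
      ∑R≡ = trans (∑-swap cols (picks S) _)
        (trans (∑-cong (picks S) λ (w , S′) → *-distribˡ-∑ (𝟙 (hits A v c w)) cols _)
          (sym (∑-map cons-u (picks S) (picks-hits A v c))))

    -- The bound covers every `v`, in `S` or not, since it is applied to the vertex about to be
    -- added to `S`.
    Sparse : ℕ → Colours → List (Fin n) → Set
    Sparse D A S = ∀ v {c} → c ∈ cols → ∑ S (𝟙 ∘ hits A v c) ≤ D

    Rich : ℕ → Colours → Set
    Rich k A = ∀ v → k ≤ ∑ cols (𝟙 ∘ A v)

    module _ (uniq : Unique cols) {D : ℕ} .{{_ : NonZero D}} {A : Colours}
             (rich : Rich (4 * D) A) where

      -- At most `D` neighbours of `v` in `S` can take `c`, and by hypothesis each accounts for at
      -- most a share `1/(2D)` of the colourings of `S`. Hence blocking loses at most half of them.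
      colourings-block-half : ∀ S → Sparse D A S →
        All (λ (w , S′) → 2 * D * colourings S′ A ≤ colourings S A) (picks S) →
        ∀ v {c} → c ∈ cols → colourings S A ≤ 2 * colourings S (block A v c)
      colourings-block-half S sparse ih v {c} c∈ = *-cancelˡ-≤ D (+-cancelʳ-≤ (D * N) _ _ (begin
        D * N + D * N                          ≡⟨ double D N ⟩
        2 * D * N
          ≤⟨ *-monoʳ-≤ (2 * D) (colourings-block uniq S A v c) ⟩
        2 * D * (B + ∑ (picks S) (picks-hits A v c))
          ≡⟨ *-distribˡ-+ (2 * D) B _ ⟩
        2 * D * B + 2 * D * ∑ (picks S) (picks-hits A v c)
          ≡⟨ cong₂ _+_ (assoc D B) (sym (*-distribˡ-∑ (2 * D) (picks S) _)) ⟩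
        D * (2 * B) + ∑ (picks S) (λ p → 2 * D * picks-hits A v c p)
          ≤⟨ +-monoʳ-≤ (D * (2 * B)) (∑-mono (picks S) λ {(w , S′)} p∈ → ≤-trans
               (≤-reflexive (*-left-comm (2 * D) (𝟙 (hits A v c w)) _))
               (*-monoʳ-≤ (𝟙 (hits A v c w)) (All.lookup ih p∈))) ⟩
        D * (2 * B) + ∑ (picks S) (λ (w , _) → 𝟙 (hits A v c w) * N)
          ≡⟨ cong (D * (2 * B) +_) (trans (*-distribʳ-∑ N (picks S) _)
               (cong (_* N) (∑-picks S (𝟙 ∘ hits A v c)))) ⟩
        D * (2 * B) + ∑ S (𝟙 ∘ hits A v c) * N
          ≤⟨ +-monoʳ-≤ (D * (2 * B)) (*-monoˡ-≤ N (sparse v c∈)) ⟩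
        D * (2 * B) + D * N                    ∎))
        where
        open ≤-Reasoning
        N B : ℕ
        N = colourings S A
        B = colourings S (block A v c)
        double : ∀ d m → d * m + d * m ≡ 2 * d * m
        double = solve-∀
        assoc : ∀ d b → 2 * d * b ≡ d * (2 * b)
        assoc = solve-∀

      -- Each of the at least `4 * D` colours available at `v` extends at least half of the
      -- colourings of `S`.
      colourings-extend : ∀ S → Sparse D A S →
        All (λ (w , S′) → 2 * D * colourings S′ A ≤ colourings S A) (picks S) →
        ∀ v → 2 * D * colourings S A ≤ colourings (v ∷ S) A
      colourings-extend S sparse ih v = *-cancelˡ-≤ 2 (begin
        2 * (2 * D * N)                        ≡⟨ assoc D N ⟩
        4 * D * N                              ≤⟨ *-monoˡ-≤ N (rich v) ⟩
        ∑ cols (𝟙 ∘ A v) * N                   ≡⟨ *-distribʳ-∑ N cols _ ⟨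
        ∑ cols (λ c → 𝟙 (A v c) * N)
          ≤⟨ ∑-mono cols (λ {c} c∈ → ≤-trans
               (*-monoʳ-≤ (𝟙 (A v c)) (colourings-block-half S sparse ih v c∈))
               (≤-reflexive (*-left-comm (𝟙 (A v c)) 2 _))) ⟩
        ∑ cols (λ c → 2 * (𝟙 (A v c) * colourings S (block A v c)))
          ≡⟨ *-distribˡ-∑ 2 cols _ ⟩
        2 * colourings (v ∷ S) A               ∎)
        where
        open ≤-Reasoning
        N : ℕ
        N = colourings S A
        assoc : ∀ d m → 2 * (2 * d * m) ≡ 4 * d * m
        assoc = solve-∀

      sparse-tail : ∀ {S w S′} → S ↭ w ∷ S′ → Sparse D A S → Sparse D A S′
      sparse-tail p sparse v {c} c∈ = ≤-trans (m≤n+m _ _)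
        (≤-trans (≤-reflexive (sym (∑-↭ (𝟙 ∘ hits A v c) p))) (sparse v c∈))

      -- Induction on the length, with `m` as an explicit bound for termination: adding `w` back to
      -- the shorter list `S′` supplies the hypothesis of `colourings-extend`.
      colourings-growth : ∀ m S → length S ≤ m → Sparse D A S →
        ∀ v → 2 * D * colourings S A ≤ colourings (v ∷ S) A
      colourings-growth m S len sparse =
        colourings-extend S sparse (All.map (removal m len) (picks-↭ S))
        where
        removal : ∀ m → length S ≤ m → ∀ {p} → S ↭ proj₁ p ∷ proj₂ p →
          2 * D * colourings (proj₂ p) A ≤ colourings S A
        removal zero    len p with () ← subst (_≤ 0) (↭-length p) len
        removal (suc m) len {w , S′} p = ≤-trans
          (colourings-growth m S′ (≤-pred (subst (_≤ suc m) (↭-length p) len))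
            (sparse-tail p sparse) w)
          (≤-reflexive (sym (colourings-↭ p A)))

      sparse-colourable : ∀ S → Sparse D A S → Colourable S A
      sparse-colourable S sparse = 0<colourings⇒Colourable S A (positive S sparse)
        where
        positive : ∀ S → Sparse D A S → 0 < colourings S A
        positive []      _      = s≤s z≤n
        positive (v ∷ S) sparse = ≤-trans
          (*-mono-≤ {1} (≤-trans (>-nonZero⁻¹ D) (m≤m+n D _)) (positive S tail))
          (colourings-growth (length S) S ≤-refl tail v)
          where
          tail : Sparse D A S
          tail = sparse-tail {v ∷ S} {v} {S} refl↭ sparse

    -- The square-root bound.

    ∖-rich : Unique cols → ∀ {k} A c → Rich (suc k) A → Rich k (A ∖ c)
    ∖-rich uniq {k} A c rich v = +-cancelˡ-≤ 1 _ _ (begin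
      suc k                                                    ≤⟨ rich v ⟩
      ∑ cols (𝟙 ∘ A v)
        ≤⟨ ∑-mono cols (λ {c′} _ → cover (A v c′) (c ≡ᵇ c′)) ⟩
      ∑ cols (λ c′ → 𝟙 (c ≡ᵇ c′) + 𝟙 ((A ∖ c) v c′))
        ≡⟨ ∑-distrib-+ cols _ _ ⟩
      ∑ cols (λ c′ → 𝟙 (c ≡ᵇ c′)) + ∑ cols (𝟙 ∘ (A ∖ c) v)
        ≤⟨ +-monoˡ-≤ _ (∑-≡ᵇ≤1 c uniq) ⟩
      1 + ∑ cols (𝟙 ∘ (A ∖ c) v)                               ∎)
      where
      open ≤-Reasoning
      cover : ∀ a x → 𝟙 a ≤ 𝟙 x + 𝟙 (a ∧ not x)
      cover false x     = z≤n
      cover true  false = ≤-refl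
      cover true  true  = ≤-refl

    dense-or-sparse : ∀ s A S →
      (∃₂ λ u c → s ≤ ∑ S (𝟙 ∘ hits A u c)) ⊎ Sparse s A S
    dense-or-sparse s A S
      with any? (λ u → Any.any? (λ c → s ≤? ∑ S (𝟙 ∘ hits A u c)) cols)
    ... | yes (u , found) with find found
    ...   | c , _ , dense = inj₁ (u , c , dense)
    dense-or-sparse s A S | no none =
      inj₂ λ v c∈ → <⇒≤ (≰⇒> λ dense → none (v , lose c∈ dense))

    -- Here `t` bounds the number of dense steps still possible: each removes at least `s` vertices
    -- and costs one colour, so `4 * s` colours are left whenever the sparse case is reached.
    sqrt-colourable : TriangleFree G → Unique cols → ∀ s .{{_ : NonZero s}} t S A →
      length S ≤ t * s → Rich (t + 4 * s) A → Colourable S A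
    sqrt-colourable tf uniq s zero    []  A len rich = (λ _ → 0) , (λ _ ()) , λ _ _ ()
    sqrt-colourable tf uniq s (suc t) S   A len rich with dense-or-sparse s A S
    ... | inj₂ sparse =
      sparse-colourable uniq (λ v → ≤-trans (m≤n+m (4 * s) (suc t)) (rich v)) S sparse
    ... | inj₁ (u , c , dense) = colour-neighbours tf A u c S
      (sqrt-colourable tf uniq s t (rest (hits A u c) S) (A ∖ c)
        (+-cancelˡ-≤ s _ _ (≤-trans (+-monoˡ-≤ _ dense)
          (≤-trans (≤-reflexive (length-rest (hits A u c) S)) len)))
        (∖-rich uniq A c rich))

  -- The degree bound.

  module _ (d e : ℕ) (e+d≡n : e + d ≡ n) where

    -- n ^ length cs times the probability that v stays uncoloured when each
    -- colour c of cs is given to the neighbourhood of a random vertex and v has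
    -- degree exactly d; here e = n - d.
    weight : Colours → Fin n → List ℕ → ℕ
    weight A v []       = 1
    weight A v (c ∷ cs) = (if A v c then e else n) * weight A v cs

    weight-∖ : ∀ A v c {cs} → All (c ≢_) cs → weight (A ∖ c) v cs ≡ weight A v cs
    weight-∖ A v c []                  = refl
    weight-∖ A v c (_∷_ {c′} c≢c′ c∉)
      rewrite ≢⇒≡ᵇ-false c c′ c≢c′ | ∧-identityʳ (A v c′) =
      cong ((if A v c′ then e else n) *_) (weight-∖ A v c c∉)

    -- Each colour available at `v` contributes a factor `e` in place of `n`, so `k` of them give
    -- the ratio `(e/n)^k`; the factor `n ^ k` avoids division.
    weight-upper : ∀ A v cs k → k ≤ ∑ cs (𝟙 ∘ A v) →
      n ^ k * weight A v cs ≤ e ^ k * n ^ length cs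
    weight-upper A v []       zero    le = ≤-refl
    weight-upper A v (c ∷ cs) k       le with A v c
    weight-upper A v (c ∷ cs) k       le | false = begin
      n ^ k * (n * weight A v cs)       ≡⟨ *-left-comm (n ^ k) n _ ⟩
      n * (n ^ k * weight A v cs)       ≤⟨ *-monoʳ-≤ n (weight-upper A v cs k le) ⟩
      n * (e ^ k * n ^ length cs)       ≡⟨ *-left-comm n (e ^ k) _ ⟩
      e ^ k * (n * n ^ length cs)       ∎
      where open ≤-Reasoning
    -- Available colours beyond the first `k` are not exploited: their factor `e` is bounded by `n`.
    weight-upper A v (c ∷ cs) zero    le | true  = begin
      1 * (e * weight A v cs)           ≡⟨ *-identityˡ _ ⟩
      e * weight A v cs                 ≤⟨ *-mono-≤ (subst (e ≤_) e+d≡n (m≤m+n e d))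
                                             (subst₂ _≤_ (*-identityˡ _) (*-identityˡ _)
                                               (weight-upper A v cs zero z≤n)) ⟩
      n * n ^ length cs                 ≡⟨ *-identityˡ _ ⟨
      1 * (n * n ^ length cs)           ∎
      where open ≤-Reasoning
    weight-upper A v (c ∷ cs) (suc k) le | true  = begin
      n * n ^ k * (e * weight A v cs)   ≡⟨ *-interchange n (n ^ k) e _ ⟩
      n * e * (n ^ k * weight A v cs)   ≤⟨ *-monoʳ-≤ (n * e) (weight-upper A v cs k (≤-pred le)) ⟩
      n * e * (e ^ k * n ^ length cs)   ≡⟨ regroup n e (e ^ k) _ ⟩
      e * e ^ k * (n * n ^ length cs)   ∎
      where
      open ≤-Reasoning
      regroup : ∀ a b c d → a * b * (c * d) ≡ b * c * (a * d)
      regroup = solve-∀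

    -- Double counting: summed over all `u`, the weight of `g` on the neighbours of `u` counts each
    -- `v` in `S` with multiplicity `degree G v`, which is at least `d`. The vertex `v₀` only shows
    -- that there is something to average over.
    popular-vertex : MinDegreeAtLeast G d → Fin n → ∀ S (g : Fin n → ℕ) →
      ∃ λ u → d * ∑ S g ≤ n * ∑ S (λ v → 𝟙 (adj G u v) * g v)
    popular-vertex deg v₀ S g = averaging (d * ∑ S g) (allFin n) _
      (subst (0 <_) (sym length-allFin) (0<n v₀)) (begin
        d * ∑ S g * length (allFin n)      ≡⟨ cong (d * ∑ S g *_) length-allFin ⟩
        d * ∑ S g * n                      ≡⟨ *-comm (d * ∑ S g) n ⟩
        n * (d * ∑ S g)                    ≡⟨ cong (n *_) (*-distribˡ-∑ d S g) ⟨
        n * ∑ S (λ v → d * g v)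
          ≤⟨ *-monoʳ-≤ n (∑-mono S λ {v} _ → *-monoˡ-≤ (g v) (deg v)) ⟩
        n * ∑ S (λ v → degree G v * g v)
          ≡⟨ cong (n *_) (∑-cong S λ v → *-distribʳ-∑ (g v) (allFin n) (𝟙 ∘ adj G v)) ⟨
        n * ∑ S (λ v → ∑ (allFin n) (λ u → 𝟙 (adj G v u) * g v))
          ≡⟨ cong (n *_) (∑-cong S λ v → ∑-cong (allFin n) λ u →
               cong (λ a → 𝟙 a * g v) (symm G v u)) ⟩
        n * ∑ S (λ v → ∑ (allFin n) (λ u → 𝟙 (adj G u v) * g v))
          ≡⟨ cong (n *_) (∑-swap S (allFin n) _) ⟩
        n * ∑ (allFin n) (λ u → ∑ S (λ v → 𝟙 (adj G u v) * g v))
          ≡⟨ *-distribˡ-∑ n (allFin n) _ ⟨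
        ∑ (allFin n) (λ u → n * ∑ S (λ v → 𝟙 (adj G u v) * g v)) ∎)
      where
      open ≤-Reasoning
      length-allFin : length (allFin n) ≡ n
      length-allFin = length-tabulate {n = n} (λ i → i)
      0<n : ∀ {m} → Fin m → 0 < m
      0<n {suc m} _ = s≤s z≤n

    -- For a popular vertex u the total weight of the uncoloured vertices, relative to
    -- n ^ length cs, does not increase; once no colour is left it counts these vertices.
    degree-colourable : TriangleFree G → MinDegreeAtLeast G d → ∀ {cs} → Unique cs → ∀ S A →
      ∑ S (λ v → weight A v cs) < n ^ length cs → Colourable S A
    degree-colourable tf deg uniq [] A _ = (λ _ → 0) , (λ _ ()) , λ _ _ ()
    degree-colourable tf deg [] (v ∷ S) A (s≤s ())
    degree-colourable tf deg {c ∷ cs} (c∉ ∷ uniq) S@(v₀ ∷ _) A small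
      with popular-vertex deg v₀ S (λ v → 𝟙 (A v c) * weight A v cs)
    ... | u , popular = colour-neighbours tf A u c S
      (degree-colourable tf deg uniq S′ (A ∖ c)
        (subst (_< n ^ length cs) (sym (∑-cong S′ λ v → weight-∖ A v c c∉))
          (*-cancelˡ-< n _ _ (≤-<-trans shrink small))))
      where
      open ≤-Reasoning
      S′ : List (Fin n)
      S′ = rest (hits A u c) S

      W : Fin n → ℕ
      W v = weight A v cs

      H : ℕ
      H = ∑ S (λ v → 𝟙 (adj G u v) * (𝟙 (A v c) * W v))

      𝟙-hits : ∀ v → 𝟙 (hits A u c v) * W v ≡ 𝟙 (adj G u v) * (𝟙 (A v c) * W v)
      𝟙-hits v = trans (cong (_* W v) (𝟙-∧ (adj G u v) (A v c))) (*-assoc (𝟙 (adj G u v)) _ _)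

      weight-split : ∀ v → n * W v ≡ weight A v (c ∷ cs) + d * (𝟙 (A v c) * W v)
      weight-split v with A v c
      ... | true  = trans (cong (_* W v) (sym e+d≡n)) (lemma e d (W v))
        where
        lemma : ∀ e d w → (e + d) * w ≡ e * w + d * (1 * w)
        lemma = solve-∀
      ... | false = lemma n d (W v)
        where
        lemma : ∀ n d w → n * w ≡ n * w + d * 0
        lemma = solve-∀

      -- By `weight-split`, dropping `c` from the weights costs `d * W v` at every `v` where `c` is
      -- available. `popular` says that the weight `n * H` removed with the newly coloured vertices
      -- pays for it; adding `n * H` to both sides avoids subtraction.
      shrink : n * ∑ S′ W ≤ ∑ S (λ v → weight A v (c ∷ cs))
      shrink = +-cancelˡ-≤ (n * H) _ _ (begin
        n * H + n * ∑ S′ W       ≡⟨ *-distribˡ-+ n H _ ⟨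
        n * (H + ∑ S′ W)
          ≡⟨ cong (λ h → n * (h + ∑ S′ W)) (∑-cong S 𝟙-hits) ⟨
        n * (∑ S (λ v → 𝟙 (hits A u c v) * W v) + ∑ S′ W)
          ≡⟨ cong (n *_) (∑-rest (hits A u c) S W) ⟩
        n * ∑ S W                ≡⟨ *-distribˡ-∑ n S W ⟨
        ∑ S (λ v → n * W v)      ≡⟨ ∑-cong S weight-split ⟩
        ∑ S (λ v → weight A v (c ∷ cs) + d * (𝟙 (A v c) * W v))
          ≡⟨ ∑-distrib-+ S (λ v → weight A v (c ∷ cs)) _ ⟩
        ∑ S (λ v → weight A v (c ∷ cs)) + ∑ S (λ v → d * (𝟙 (A v c) * W v))
          ≡⟨ cong (∑ S (λ v → weight A v (c ∷ cs)) +_) (*-distribˡ-∑ d S _) ⟩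
        ∑ S (λ v → weight A v (c ∷ cs)) + d * ∑ S (λ v → 𝟙 (A v c) * W v)
          ≤⟨ +-monoʳ-≤ _ popular ⟩
        ∑ S (λ v → weight A v (c ∷ cs)) + n * H
          ≡⟨ +-comm _ (n * H) ⟩
        n * H + ∑ S (λ v → weight A v (c ∷ cs)) ∎)

    -- The union bound: by `weight-upper`, each of the `length S` vertices has relative weight at
    -- most `(e/n)^k`.
    weight-small : .{{_ : NonZero n}} → ∀ A S cs k → (∀ v → k ≤ ∑ cs (𝟙 ∘ A v)) → length S * e ^ k < n ^ k →
      ∑ S (λ v → weight A v cs) < n ^ length cs
    weight-small A S cs k rich small = *-cancelˡ-< (n ^ k) _ _ (begin-strict
      n ^ k * ∑ S (λ v → weight A v cs)    ≡⟨ *-distribˡ-∑ (n ^ k) S _ ⟨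
      ∑ S (λ v → n ^ k * weight A v cs)
        ≤⟨ ∑-mono S (λ {v} _ → weight-upper A v cs k (rich v)) ⟩
      ∑ S (λ v → e ^ k * n ^ length cs)    ≡⟨ ∑-const _ S ⟩
      length S * (e ^ k * n ^ length cs)   ≡⟨ *-assoc (length S) _ _ ⟨
      length S * e ^ k * n ^ length cs     <⟨ *-monoˡ-< (n ^ length cs) small ⟩
      n ^ k * n ^ length cs                ∎)
      where
      open ≤-Reasoning
      instance
        n^≢0 : NonZero (n ^ length cs)
        n^≢0 = m^n≢0 n (length cs)

  -- From list assignments to available colours.

  choosable-from-rich : ∀ k →
    (∀ {cols} → Unique cols → ∀ A → Rich cols k A → Colourable (allFin n) A) → Choosable G k
  choosable-from-rich k colour L len uniq = choice (colour (upTo⁺ bound) A rich)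
    where
    bound : ℕ
    -- The sum of all entries of all lists exceeds no less than each colour, so `upTo bound` is a
    -- finite palette without repetitions containing every list.
    bound = suc (∑ (allFin n) (sum ∘ L))

    A : Colours
    A v c = ⌊ c ∈? L v ⌋

    below-bound : ∀ v {c} → c ∈ L v → c < bound
    below-bound v c∈ = s≤s (≤-trans (∈⇒≤sum c∈) (term≤∑ (sum ∘ L) (∈-allFin v)))

    rich : Rich (upTo bound) k A
    rich v = subst (_≤ ∑ (upTo bound) (𝟙 ∘ A v)) (len v)
      (length≤∑ (upTo bound) (uniq v) λ c∈ → ∈-upTo⁺ (below-bound v c∈))

    choice : Colourable (allFin n) A → Σ (Fin n → ℕ) λ f →
      (∀ v → f v ∈ L v) × (∀ u v → adj G u v ≡ true → f u ≢ f v)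
    choice (f , ok , proper) = f
      , (λ v → toWitness {a? = f v ∈? L v} (subst T (sym (ok v (∈-allFin v))) _))
      , λ u v → proper u v (∈-allFin u) (∈-allFin v)

  -- As `n ≤ s * s`, at most `s` dense steps occur; they use up the first summand of `s + 4 * s`.
  choosable-sqrt : TriangleFree G → ∀ s .{{_ : NonZero s}} → n ≤ s * s → Choosable G (s + 4 * s)
  choosable-sqrt tf s n≤s² = choosable-from-rich (s + 4 * s) λ {cols} uniq A →
    sqrt-colourable cols tf uniq s s (allFin n) A
      (subst (_≤ s * s) (sym (length-tabulate {n = n} (λ i → i))) n≤s²)

  choosable-degree : .{{_ : NonZero n}} → TriangleFree G → ∀ {d} → MinDegreeAtLeast G d →
    ∀ {e} → e + d ≡ n → ∀ k → n * e ^ k < n ^ k → Choosable G k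
  choosable-degree tf {d} deg {e} e+d≡n k small = choosable-from-rich k λ {cols} uniq A rich →
    degree-colourable d e e+d≡n tf deg uniq (allFin n) A
      (weight-small d e e+d≡n A (allFin n) cols k rich
        (subst (λ m → m * e ^ k < n ^ k) (sym (length-tabulate {n = n} (λ i → i))) small))

  degree≤n : ∀ v → degree G v ≤ n
  degree≤n v = begin
    ∑ (allFin n) (𝟙 ∘ adj G v)    ≤⟨ ∑-mono (allFin n) (λ {w} _ → 𝟙≤1 (adj G v w)) ⟩
    ∑ (allFin n) (λ _ → 1)        ≡⟨ ∑-const 1 (allFin n) ⟩
    length (allFin n) * 1         ≡⟨ *-identityʳ _ ⟩
    length (allFin n)             ≡⟨ length-tabulate {n = n} (λ i → i) ⟩
    n                             ∎
    where
    open ≤-Reasoning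
    𝟙≤1 : ∀ b → 𝟙 b ≤ 1
    𝟙≤1 true  = ≤-refl
    𝟙≤1 false = z≤n

-- Numerical estimates.

-- Bernoulli's inequality for `(1 + d/e)^q`, cleared of denominators.
bernoulli : ∀ e d q → e ^ q * (e + q * d) ≤ e * (e + d) ^ q
bernoulli e d zero    = ≤-reflexive (lemma e)
  where
  lemma : ∀ e → 1 * (e + 0) ≡ e * 1
  lemma = solve-∀
bernoulli e d (suc q) = begin
  e * e ^ q * (e + (d + q * d))
    ≤⟨ m≤m+n _ (e ^ q * (q * d * d)) ⟩
  e * e ^ q * (e + (d + q * d)) + e ^ q * (q * d * d)
    ≡⟨ expand e d q (e ^ q) ⟩
  (e + d) * (e ^ q * (e + q * d))
    ≤⟨ *-monoʳ-≤ (e + d) (bernoulli e d q) ⟩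
  (e + d) * (e * (e + d) ^ q)
    ≡⟨ *-left-comm (e + d) e _ ⟩
  e * ((e + d) * (e + d) ^ q) ∎
  where
  open ≤-Reasoning
  expand : ∀ e d q p → e * p * (e + (d + q * d)) + p * (q * d * d) ≡ (e + d) * (p * (e + q * d))
  expand = solve-∀

-- With `n = e + d` this says `(1 - d/n)^(q+1) ≤ 1/2`. Bernoulli gives it because `suc q * d` is at
-- least `e`.
2*^≤ : ∀ e d q → e + d ≤ suc q * d → 2 * e ^ suc q ≤ (e + d) ^ suc q
2*^≤ zero      d q le = z≤n
2*^≤ e@(suc _) d q le = *-cancelˡ-≤ e (begin
  e * (2 * e ^ suc q)             ≡⟨ regroup e (e ^ suc q) ⟩
  e ^ suc q * (e + e)             ≤⟨ *-monoʳ-≤ (e ^ suc q) (+-monoʳ-≤ e (≤-trans (m≤m+n e d) le)) ⟩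
  e ^ suc q * (e + suc q * d)     ≤⟨ bernoulli e d (suc q) ⟩
  e * (e + d) ^ suc q             ∎)
  where
  open ≤-Reasoning
  regroup : ∀ e p → e * (2 * p) ≡ p * (e + e)
  regroup = solve-∀

^-distribʳ-* : ∀ j a b → (a * b) ^ j ≡ a ^ j * b ^ j
^-distribʳ-* zero    a b = refl
^-distribʳ-* (suc j) a b = trans (cong (a * b *_) (^-distribʳ-* j a b))
  (*-interchange a b (a ^ j) (b ^ j))

2^*^≤ : ∀ e d q j → e + d ≤ suc q * d → 2 ^ j * e ^ (suc q * j) ≤ (e + d) ^ (suc q * j)
2^*^≤ e d q j le = begin
  2 ^ j * e ^ (suc q * j)       ≡⟨ cong (2 ^ j *_) (^-*-assoc e (suc q) j) ⟨
  2 ^ j * (e ^ suc q) ^ j       ≡⟨ ^-distribʳ-* j 2 (e ^ suc q) ⟨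
  (2 * e ^ suc q) ^ j           ≤⟨ ^-monoˡ-≤ j (2*^≤ e d q le) ⟩
  ((e + d) ^ suc q) ^ j         ≡⟨ ^-*-assoc (e + d) (suc q) j ⟩
  (e + d) ^ (suc q * j)         ∎
  where open ≤-Reasoning

n<2^[1+log₂n] : ∀ n → n < 2 ^ suc ⌊log₂ n ⌋
n<2^[1+log₂n] n = ≰⇒> λ le →
  1+n≰n (subst (_≤ ⌊log₂ n ⌋) (⌊log₂[2^n]⌋≡n (suc ⌊log₂ n ⌋)) (⌊log₂⌋-mono-≤ le))

-- Every `suc q` factors `e/n` contribute at most `1/2`, and `2 ^ suc ⌊log₂ n⌋` exceeds `n`.
n*e^k<n^k : ∀ e d q .{{_ : NonZero (e + d)}} → e + d ≤ suc q * d →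
  let n = e + d; k = suc q * suc ⌊log₂ n ⌋ in n * e ^ k < n ^ k
n*e^k<n^k e d q le = helper (e ^ k)
  (≤-trans (*-monoˡ-≤ (e ^ k) (n<2^[1+log₂n] n)) (2^*^≤ e d q (suc ⌊log₂ n ⌋) le))
  where
  n k : ℕ
  n = e + d
  k = suc q * suc ⌊log₂ n ⌋
  -- The gap between `n * p` and `suc n * p` is strict only for positive `p`; if `e ^ k` is 0,
  -- positivity of `n ^ k` is used instead.
  helper : ∀ p → suc n * p ≤ n ^ k → n * p < n ^ k
  helper zero    _  = subst (_< n ^ k) (sym (*-zeroʳ n)) (m^n>0 n k)
  helper (suc p) le = ≤-trans (s≤s (m≤n+m (n * suc p) p)) le

-- `s` grows only when `s * s` equals `n`, and then its new square is `n + 2 * s + 1`, at most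
-- `3 * n + 1`.
ceiling-sqrt : ∀ n → ∃ λ s → n ≤ s * s × s * s ≤ 4 * n
ceiling-sqrt zero    = 0 , z≤n , z≤n
ceiling-sqrt (suc n) with ceiling-sqrt n
... | s , n≤s² , s²≤4n with suc n ≤? s * s
...   | yes n<s² = s , n<s² , ≤-trans s²≤4n (*-monoʳ-≤ 4 (n≤1+n n))
...   | no  n≮s² = suc s , lower , upper
  where
  open ≤-Reasoning
  s²≤n : s * s ≤ n
  s²≤n = ≤-pred (≰⇒> n≮s²)

  s≤s² : ∀ s → s ≤ s * s
  s≤s² zero    = z≤n
  s≤s² (suc s) = m≤m+n (suc s) _

  square : ∀ s → suc s * suc s ≡ suc (s * s + 2 * s)
  square = solve-∀

  lower : suc n ≤ suc s * suc s
  lower = subst (suc n ≤_) (sym (square s)) (s≤s (≤-trans n≤s² (m≤m+n _ _)))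

  upper : suc s * suc s ≤ 4 * suc n
  upper = begin
    suc s * suc s           ≡⟨ square s ⟩
    suc (s * s + 2 * s)     ≤⟨ s≤s (+-mono-≤ s²≤n (*-monoʳ-≤ 2 (≤-trans (s≤s² s) s²≤n))) ⟩
    suc (n + 2 * n)         ≤⟨ m≤m+n _ (3 + n) ⟩
    suc (n + 2 * n) + (3 + n) ≡⟨ lemma n ⟩
    4 * suc n               ∎
    where
    lemma : ∀ n → suc (n + 2 * n) + (3 + n) ≡ 4 * suc n
    lemma = solve-∀

-- One `k` under both bounds encodes the minimum; squaring the first and multiplying the second by
-- `d` keeps them in ℕ. For `n ≥ 1`, `⌊log₂ n⌋` is at most `log n / log 2`, so natural logarithms
-- only change the constant. A real `d` may be rounded up, as degrees are integers.
theorem1p6 : Σ ℕ λ C → 1 ≤ C ×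
    ((n d : ℕ) → 1 ≤ d → (G : Graph n) → TriangleFree G → MinDegreeAtLeast G d →
    ListChromaticAtMost G (λ k → (k * k ≤ C * C * n) × (k * d ≤ C * n * ⌊log₂ n ⌋)))
-- The square-root bound dictates 10: `k₁ * k₁` is `25 * (s * s)`, at most `100 * n`. The degree
-- bound needs only 4.
theorem1p6 = 10 , s≤s z≤n , bound
  where
  bound : (n d : ℕ) → 1 ≤ d → (G : Graph n) → TriangleFree G → MinDegreeAtLeast G d →
    ListChromaticAtMost G (λ k → (k * k ≤ 10 * 10 * n) × (k * d ≤ 10 * n * ⌊log₂ n ⌋))
  bound zero d 1≤d G tf deg =
    0 , (λ L _ _ → (λ ()) , (λ ()) , (λ ())) , z≤n , z≤n
  -- The logarithm vanishes for one vertex, but that vertex has degree 0, contrary to `1 ≤ d`.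
  bound (suc zero) d 1≤d G tf deg =
    contradiction (≤-trans 1≤d (deg Fin.zero)) λ 1≤deg →
      1+n≰n (subst (λ b → 1 ≤ 𝟙 b + 0) (irrefl G Fin.zero) 1≤deg)
  bound n@(suc (suc n₀)) d@(suc _) 1≤d G tf deg = combine (≤-total k₁ k₂)
    where
    open ≤-Reasoning
    ℓ s q e k₁ k₂ : ℕ
    ℓ  = ⌊log₂ n ⌋
    s  = proj₁ (ceiling-sqrt n)
    q  = n / d
    e  = n ∸ d
    k₁ = s + 4 * s
    k₂ = suc q * suc ℓ

    d≤n : d ≤ n
    d≤n = ≤-trans (deg Fin.zero) (degree≤n G Fin.zero)

    e+d≡n : e + d ≡ n
    e+d≡n = m∸n+n≡m d≤n

    n≤[1+q]*d : n ≤ suc q * d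
    n≤[1+q]*d = subst (_≤ suc q * d) (sym (m≡m%n+[m/n]*n n d))
      (+-monoˡ-≤ (q * d) (<⇒≤ (m%n<n n d)))

    1≤ℓ : 1 ≤ ℓ
    1≤ℓ = subst (_≤ ℓ) (⌊log₂[2^n]⌋≡n 1) (⌊log₂⌋-mono-≤ (s≤s (s≤s (z≤n {n₀}))))

    instance
      s≢0 : NonZero s
      s≢0 = ≢-nonZero λ s≡0 →
        case subst (λ s → n ≤ s * s) s≡0 (proj₁ (proj₂ (ceiling-sqrt n))) of λ ()

    choosable₁ : Choosable G k₁
    choosable₁ = choosable-sqrt G tf s (proj₁ (proj₂ (ceiling-sqrt n)))

    small : n * e ^ k₂ < n ^ k₂
    small = subst (λ m → m * e ^ (suc q * suc ⌊log₂ m ⌋) < m ^ (suc q * suc ⌊log₂ m ⌋)) e+d≡n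
      (n*e^k<n^k e d q {{subst NonZero (sym e+d≡n) _}}
        (subst (_≤ suc q * d) (sym e+d≡n) n≤[1+q]*d))

    choosable₂ : Choosable G k₂
    choosable₂ = choosable-degree G tf deg e+d≡n k₂ small

    k₁-bound : k₁ * k₁ ≤ 10 * 10 * n
    k₁-bound = begin
      k₁ * k₁             ≡⟨ lemma s ⟩
      25 * (s * s)        ≤⟨ *-monoʳ-≤ 25 (proj₂ (proj₂ (ceiling-sqrt n))) ⟩
      25 * (4 * n)        ≡⟨ *-assoc 25 4 n ⟨
      10 * 10 * n         ∎
      where
      lemma : ∀ s → (s + 4 * s) * (s + 4 * s) ≡ 25 * (s * s)
      lemma = solve-∀

    k₂-bound : k₂ * d ≤ 10 * n * ℓ
    k₂-bound = begin
      suc q * suc ℓ * d         ≡⟨ lemma q ℓ d ⟩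
      -- The two successors in `k₂` cost a factor 2 each: `d ≤ n` absorbs one, and `1 ≤ ℓ`, from
      -- `n ≥ 2`, the other.
      (d + q * d) * (1 + ℓ)     ≤⟨ *-mono-≤ (+-mono-≤ d≤n (m/n*n≤m n d)) (+-monoˡ-≤ ℓ 1≤ℓ) ⟩
      (n + n) * (ℓ + ℓ)         ≡⟨ lemma′ n ℓ ⟩
      4 * n * ℓ                 ≤⟨ *-monoˡ-≤ ℓ (*-monoˡ-≤ n (m≤m+n 4 6)) ⟩
      10 * n * ℓ                ∎
      where
      lemma : ∀ q ℓ d → (1 + q) * (1 + ℓ) * d ≡ (d + q * d) * (1 + ℓ)
      lemma = solve-∀
      lemma′ : ∀ n ℓ → (n + n) * (ℓ + ℓ) ≡ 4 * n * ℓ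
      lemma′ = solve-∀

    -- Both bounds are monotone in `k`, so the smaller of `k₁` and `k₂` satisfies both.
    combine : k₁ ≤ k₂ ⊎ k₂ ≤ k₁ →
      ListChromaticAtMost G (λ k → (k * k ≤ 10 * 10 * n) × (k * d ≤ 10 * n * ℓ))
    combine (inj₁ k₁≤k₂) = k₁ , choosable₁ , k₁-bound , ≤-trans (*-monoˡ-≤ d k₁≤k₂) k₂-bound
    combine (inj₂ k₂≤k₁) = k₂ , choosable₂ , ≤-trans (*-mono-≤ k₂≤k₁ k₂≤k₁) k₁-bound , k₂-bound
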